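{- There exists a constant $c_0>0$ such that for every integer $n\geq 1$, every real matrix with $64n^4$ rows and $2^{c_0n^4(\log n)^2}$ columns contains an $n\times n$ monotone submatrix.
   Context: An $n\times n$ submatrix of a real matrix $A$ is obtained by choosing row indices $i_1<\dots<i_n$ and column indices $j_1<\dots<j_n$ and taking $B(k,l)=A(i_k,j_l)$. A finite sequence of reals is monotone if it is non-decreasing or non-increasing. A matrix is monotone if every row is monotone with all rows of the same type (all non-decreasing or all non-increasing), and every column is monotone with all columns of the same type. -}

module Defs where

open import Data.Nat using (ℕ)
open import Data.Fin using (Fin) renaming (_<_ to _<ᶠ_)
open import Data.Sum using (_⊎_)
open import Data.Product using (_×_; Σ-syntax)
open import Relation.Binary.Bundles using (TotalOrder)
open import Level using (0ℓ)

module _ (O : TotalOrder 0ℓ 0ℓ 0ℓ) where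
  open TotalOrder O renaming (Carrier to A)

  Matrix : ℕ → ℕ → Set
  Matrix m N = Fin m → Fin N → A

  StrictlyIncreasing : ∀ {n m} → (Fin n → Fin m) → Set
  StrictlyIncreasing {n} f = ∀ {i j : Fin n} → i <ᶠ j → f i <ᶠ f j

  NonDecreasing : ∀ {n} → (Fin n → A) → Set
  NonDecreasing {n} s = ∀ {i j : Fin n} → i <ᶠ j → s i ≤ s j

  NonIncreasing : ∀ {n} → (Fin n → A) → Set
  NonIncreasing {n} s = ∀ {i j : Fin n} → i <ᶠ j → s j ≤ s i

  MonotoneMatrix : ∀ {n} → Matrix n n → Set
  MonotoneMatrix B =
    ((∀ k → NonDecreasing (λ l → B k l)) ⊎ (∀ k → NonIncreasing (λ l → B k l)))
    × ((∀ l → NonDecreasing (λ k → B k l)) ⊎ (∀ l → NonIncreasing (λ k → B k l)))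

  submatrix : ∀ {n m N} → Matrix m N → (Fin n → Fin m) → (Fin n → Fin N) → Matrix n n
  submatrix M r c k l = M (r k) (c l)

  HasMonotoneSubmatrix : ∀ {m N} → ℕ → Matrix m N → Set
  HasMonotoneSubmatrix {m} {N} n M =
    Σ[ r ∈ (Fin n → Fin m) ] Σ[ c ∈ (Fin n → Fin N) ]
      (StrictlyIncreasing r × StrictlyIncreasing c × MonotoneMatrix (submatrix M r c))

{-# OPTIONS --safe #-}
-- Erdős–Szekeres on every column, followed by the pigeonhole principle, leaves q = 8n² rows on
-- which exponentially many columns are monotone of the same type.  Halving a set of columns
-- and passing to the right side of the median in every row gives two sets of columns,
-- one left of the other, such that every row compares all pairs between them in the same way; the
-- loss is a factor 2^(q+1).  Iterating yields a complete binary tree of depth H whose nodes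
-- are coloured by the 2^q possible sign vectors.  A Sauer–Shelah argument in Pajor's form finds in it
-- an embedded complete tree of depth L = 4k², k = ⌈log₂ n⌉, with one colour per level: the 2^H
-- leaves give as many distinct words over the colours and a blank symbol, while only
-- (1 + 2^q H)^L < 2^H words have at most L colours.  Averaging over the k-element sets of
-- levels, some k levels agree in sign on n rows, because (2k² choose k) / (4k² choose k) is at
-- least 2^-k / 2 > 1 / 4n.  The 2^k ≥ n leaves over these levels are the required columns.
module Submission where

open import Defs
open import Data.Nat using (ℕ; _*_; _^_; _≤_; _≥_)
open import Data.Nat.Logarithm using (⌈log₂_⌉)
open import Data.Product using (Σ-syntax; _×_)
open import Level using (0ℓ)
open import Relation.Binary.Bundles using (TotalOrder)

import Data.Bool as Bool
open import Data.Bool using (Bool; true; false)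
open import Data.Fin as Fin using (Fin; zero; suc; inject≤; combine; remQuot; fromℕ<) renaming (_<_ to _<ᶠ_)
import Data.Fin.Properties as Fin
open import Data.List as List using (List; []; _∷_; _++_; length; map; filter; take; drop;
  lookup; allFin; cartesianProduct; cartesianProductWith)
open import Data.List.Membership.Propositional using (_∈_; find; lose)
import Data.List.Membership.DecPropositional as DecMembership
open import Data.List.Membership.Propositional.Properties
open import Data.List.Properties using (filter-all; length-map; length-++;
  length-take; length-drop; length-tabulate)
open import Data.List.Relation.Binary.Disjoint.Propositional using (Disjoint)
open import Data.List.Relation.Binary.Sublist.Propositional as Sub using (_⊆_; []; _∷ʳ_; _∷_; ⊆-refl; ⊆-trans)
open import Data.List.Relation.Binary.Sublist.Propositional.Properties
  using (All-resp-⊆; filter-⊆; take-⊆; drop-⊆)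
open import Data.List.Relation.Unary.All as All using (All; []; _∷_)
open import Data.List.Relation.Unary.AllPairs as AllPairs using (AllPairs; []; _∷_)
import Data.List.Relation.Unary.AllPairs.Properties as AllPairs
open import Data.List.Relation.Unary.Any using (here; there; any?)
open import Data.List.Relation.Unary.Unique.Propositional using (Unique)
import Data.List.Relation.Unary.Unique.Propositional.Properties as Unique
open import Data.Maybe using (Maybe; just; nothing)
import Data.Maybe.Properties as Maybe
open import Data.Nat using (zero; suc; _+_; _∸_; _<_; z≤n; s≤s; _≤?_; _<?_;
  _≤′_; ≤′-refl; ≤′-step; NonZero; ⌈_/2⌉; ⌊_/2⌋; >-nonZero)
open import Data.Nat.Combinatorics using (_C_; nCk+nC[k+1]≡[n+1]C[k+1])
open import Data.Nat.Induction using (<-rec)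
open import Data.Nat.ListAction using (sum)
open import Data.Nat.Logarithm using (⌈log₂⌉-mono-≤; ⌈log₂⌈n/2⌉⌉≡⌈log₂n⌉∸1; ⌈log₂2*n⌉≡1+⌈log₂n⌉; ⌈log₂2^n⌉≡n)
open import Data.Nat.Properties
open import Data.Nat.Tactic.RingSolver using (solve-∀)
open import Data.Product using (∃; ∃₂; _,_; proj₁; proj₂)
import Data.Product.Properties as Product
open import Data.Sum using (_⊎_; inj₁; inj₂; [_,_]′)
open import Data.Vec as Vec using (Vec; []; _∷_)
import Data.Vec.Properties as Vec
open import Function using (_∘_; id)
open import Relation.Binary using (Rel; Transitive)
open import Relation.Binary.Definitions using (DecidableEquality)
open import Relation.Binary.PropositionalEquality
open import Relation.Nullary using (¬_; Dec; yes; no; contradiction; ¬?)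
open import Relation.Unary using (Decidable; Pred)

private variable
  X Y Z : Set

-- Passage from a total order to natural-number ranks.

Dir : Bool → ℕ → ℕ → Set
Dir true  x y = x ≤ y
Dir false x y = y ≤ x

Dir-trans : ∀ b → Transitive (Dir b)
Dir-trans true  p q = ≤-trans p q
Dir-trans false p q = ≤-trans q p

module _ (O : TotalOrder 0ℓ 0ℓ 0ℓ) where
  open TotalOrder O using (total) renaming (Carrier to A; _≤_ to _≼_; refl to ≼-refl; trans to ≼-trans)

  all⊎any : ∀ {K} {P Q : Fin K → Set} → (∀ i → P i ⊎ Q i) → (∀ i → P i) ⊎ ∃ Q
  all⊎any {zero}  f = inj₁ λ ()
  all⊎any {suc K} f with f zero | all⊎any (f ∘ suc)
  ... | inj₂ q | _            = inj₂ (zero , q)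
  ... | inj₁ _ | inj₂ (i , q) = inj₂ (suc i , q)
  ... | inj₁ p | inj₁ ps      = inj₁ λ { zero → p ; (suc i) → ps i }

  -- Elements that are equal in the order may receive different ranks, so equality, which a total
  -- order need not decide, never has to be tested.
  Reflects : ∀ {K} → (Fin K → ℕ) → (Fin K → A) → Set
  Reflects ρ f = ∀ i j → ρ i ≤ ρ j → f i ≼ f j

  -- The threshold descends from the bound until some `i` of rank at least `T` has `f i ≼ x`. By
  -- `Reflects` every element of rank at most `T` then lies below `x` too, so `suc T` is a valid
  -- cut.
  cut : ∀ {K} (ρ : Fin K → ℕ) (f : Fin K → A) → Reflects ρ f → (x : A) →
        ∀ T → (∀ i → ρ i < T) →
        ∃ λ T → (∀ i → ρ i < T → f i ≼ x) × (∀ i → T ≤ ρ i → x ≼ f i)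
  cut ρ f refl-ρ x T bound = go T (λ i T≤ → contradiction (bound i) (≤⇒≯ T≤))
    where
    step : ∀ T i → (T ≤ ρ i → x ≼ f i) ⊎ (T ≤ ρ i × f i ≼ x)
    step T i with T ≤? ρ i | total (f i) x
    ... | no  T≰ | _       = inj₁ λ T≤ → contradiction T≤ T≰
    ... | yes T≤ | inj₁ fx = inj₂ (T≤ , fx)
    ... | yes _  | inj₂ xf = inj₁ λ _ → xf

    go : ∀ T → (∀ i → T ≤ ρ i → x ≼ f i) →
         ∃ λ T → (∀ i → ρ i < T → f i ≼ x) × (∀ i → T ≤ ρ i → x ≼ f i)
    go zero    above = 0 , (λ _ ()) , above
    go (suc T) above with all⊎any (step T)
    ... | inj₁ above′ = go T above′
    ... | inj₂ (i , T≤ , fx) =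
      suc T , (λ j j≤ → ≼-trans (refl-ρ j i (≤-trans (≤-pred j≤) T≤)) fx) , above

  ranks : ∀ {K} (f : Fin K → A) → ∃₂ λ ρ T → Reflects ρ f × (∀ i → ρ i < T)
  ranks {zero}  f = (λ ()) , 0 , (λ ()) , (λ ())
  ranks {suc K} f with ranks (f ∘ suc)
  ... | ρ , B , refl-ρ , bound with cut ρ (f ∘ suc) refl-ρ (f zero) B bound
  ... | T , below , above = ρ′ , suc (2 * B + 2 * T) , reflects , bound′
    where
    -- Doubling the old ranks leaves the even numbers free for the new element.
    ρ′ : Fin (suc K) → ℕ
    ρ′ zero    = 2 * T
    ρ′ (suc i) = suc (2 * ρ i)

    reflects : Reflects ρ′ f
    reflects zero    zero    _ = ≼-refl
    reflects zero    (suc j) p = above j (≤-pred (*-cancelˡ-< 2 T (suc (ρ j))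
      (≤-trans (s≤s p) (≤-reflexive (sym (*-suc 2 (ρ j)))))))
    reflects (suc i) zero    p = below i (*-cancelˡ-< 2 (ρ i) T p)
    reflects (suc i) (suc j) p = refl-ρ i j (*-cancelˡ-≤ 2 (≤-pred p))

    bound′ : ∀ i → ρ′ i < suc (2 * B + 2 * T)
    bound′ zero    = s≤s (m≤n+m (2 * T) (2 * B))
    bound′ (suc i) = s≤s (≤-trans (*-monoʳ-< 2 (bound i)) (m≤m+n (2 * B) (2 * T)))

-- Sublists and the pigeonhole principle.

AllPairs-resp-⊆ : ∀ {R : Rel X 0ℓ} {xs ys} → xs ⊆ ys → AllPairs R ys → AllPairs R xs
AllPairs-resp-⊆ []         []       = []
AllPairs-resp-⊆ (_ ∷ʳ p)   (_ ∷ rs) = AllPairs-resp-⊆ p rs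
AllPairs-resp-⊆ (refl ∷ p) (r ∷ rs) = All-resp-⊆ p r ∷ AllPairs-resp-⊆ p rs

AllPairs-lookup : ∀ {R : Rel X 0ℓ} {xs} → AllPairs R xs →
                  ∀ {i j} → i <ᶠ j → R (lookup xs i) (lookup xs j)
AllPairs-lookup (r ∷ _)  {zero}  {suc j} _       = All.lookup r (∈-lookup j)
AllPairs-lookup (_ ∷ rs) {suc i} {suc j} (s≤s p) = AllPairs-lookup rs p

AllPairs-take-drop : ∀ {R : Rel X 0ℓ} {xs} → AllPairs R xs → ∀ n {x y} →
                     x ∈ take n xs → y ∈ drop n xs → R x y
AllPairs-take-drop (r ∷ _)  (suc n) (here refl) y∈ = All.lookup r (Sub.lookup (drop-⊆ n _) y∈)
AllPairs-take-drop (_ ∷ rs) (suc n) (there x∈)  y∈ = AllPairs-take-drop rs n x∈ y∈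

length-filter-∁ : ∀ {P Q : Pred X 0ℓ} (P? : Decidable P) (Q? : Decidable Q) →
                  (∀ x → ¬ P x → Q x) → ∀ xs →
                  length xs ≤ length (filter P? xs) + length (filter Q? xs)
length-filter-∁ P? Q? ¬P⇒Q [] = z≤n
length-filter-∁ P? Q? ¬P⇒Q (x ∷ xs) with P? x | Q? x | length-filter-∁ P? Q? ¬P⇒Q xs
... | yes _ | no  _ | ih = s≤s ih
... | yes _ | yes _ | ih = s≤s (≤-trans ih (+-monoʳ-≤ (length (filter P? xs)) (n≤1+n _)))
... | no  _ | yes _ | ih = ≤-trans (s≤s ih) (≤-reflexive (sym (+-suc _ _)))
... | no ¬p | no ¬q | _  = contradiction (¬P⇒Q x ¬p) ¬q

m+n<k+l⇒m<k⊎n<l : ∀ {m n k l} → m + n < k + l → m < k ⊎ n < l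
m+n<k+l⇒m<k⊎n<l {m} {n} {k} {l} p with m <? k
... | yes m<k = inj₁ m<k
... | no  m≮k = inj₂ (+-cancelˡ-< k n l (≤-<-trans (+-monoˡ-≤ n (≮⇒≥ m≮k)) p))

∈-tail : ∀ {y z : X} {ys} → z ∈ y ∷ ys → z ≢ y → z ∈ ys
∈-tail (here z≡y) z≢y = contradiction z≡y z≢y
∈-tail (there z∈) _   = z∈

-- Either `y` alone has more than `t` preimages, or the elements outside its fibre still number more
-- than `length ys * t`. The fibre is returned as a sublist, so that a sorted list of columns stays
-- sorted.
pigeonhole : (_≟_ : DecidableEquality Y) (f : X → Y) (ys : List Y) (xs : List X) (t : ℕ) →
             (∀ {x} → x ∈ xs → f x ∈ ys) → length ys * t < length xs →
             ∃₂ λ y zs → zs ⊆ xs × (∀ {z} → z ∈ zs → f z ≡ y) × t < length zs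
pigeonhole _≟_ f []       (x ∷ xs) t cover p with () ← cover (here refl)
pigeonhole _≟_ f (y ∷ ys) xs       t cover p
  with m+n<k+l⇒m<k⊎n<l {t} (<-≤-trans p
         (length-filter-∁ (λ x → f x ≟ y) (λ x → ¬? (f x ≟ y)) (λ _ → id) xs))
... | inj₁ large = y , filter (λ x → f x ≟ y) xs , filter-⊆ _ xs
                 , (λ z∈ → proj₂ (∈-filter⁻ (λ x → f x ≟ y) {xs = xs} z∈)) , large
... | inj₂ large
  with y′ , zs , zs⊆ , f≡ , big ← pigeonhole _≟_ f ys
         (filter (λ x → ¬? (f x ≟ y)) xs) t
         (λ x∈ → let x∈xs , f≢y = ∈-filter⁻ (λ x → ¬? (f x ≟ y)) {xs = xs} x∈
                 in ∈-tail (cover x∈xs) f≢y)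
         large
  = y′ , zs , ⊆-trans zs⊆ (filter-⊆ _ xs) , f≡ , big

-- The Erdős-Szekeres theorem.

module _ {m : ℕ} (x : Fin m → ℕ) where

  Step : Bool → Fin m → Fin m → Set
  Step b i j = i <ᶠ j × Dir b (x i) (x j)

  Step-trans : ∀ b → Transitive (Step b)
  Step-trans b (p , q) (p′ , q′) = Fin.<-trans p p′ , Dir-trans b q q′

  -- i ∷ rs are the running strict minima and qs is everything else.
  running-minima : ∀ i js → AllPairs _<ᶠ_ (i ∷ js) →
    ∃₂ λ rs qs → AllPairs (Step false) (i ∷ rs) × qs ⊆ js ×
      (∀ {q} → q ∈ qs → ∃ λ z → z ∈ i ∷ js × Step true z q) ×
      length js ≡ length rs + length qs
  running-minima i [] _ = [] , [] , [] ∷ [] , [] , (λ ()) , refl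
  running-minima i (j ∷ js) ((i<j ∷ i<js) ∷ sorted@(_ ∷ js-sorted)) with x i ≤? x j
  ... | yes xi≤xj
    with rs , qs , mins , qs⊆ , dom , len ← running-minima i js (i<js ∷ js-sorted)
    = rs , j ∷ qs , mins , refl ∷ qs⊆
    , (λ { (here refl) → i , here refl , i<j , xi≤xj
         ; (there q∈) → let z , z∈ , s = dom q∈ in z , insert z∈ , s })
    , trans (cong suc len) (sym (+-suc _ _))
    where
    insert : ∀ {z} → z ∈ i ∷ js → z ∈ i ∷ j ∷ js
    insert (here e)  = here e
    insert (there p) = there (there p)
  ... | no xi≰xj
    with rs , qs , mins , qs⊆ , dom , len ← running-minima j js sorted
    = j ∷ rs , qs
    , (step ∷ All.map (Step-trans false step) (AllPairs.head mins)) ∷ mins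
    , j ∷ʳ qs⊆
    , (λ q∈ → let z , z∈ , s = dom q∈ in z , there z∈ , s)
    , cong suc len
    where
    step : Step false i j
    step = i<j , <⇒≤ (≰⇒> xi≰xj)

  -- Induction on `a`. More than `b` running minima form the descending sequence. Otherwise more
  -- than `a * b` other elements remain, and an ascending sequence among them is prolonged in front
  -- by an earlier element not above its first term. Membership is recorded on the ascending side in
  -- order to find that element.
  erdős–szekeres-list : ∀ a b is → AllPairs _<ᶠ_ is → a * b < length is →
    ∃ λ js → (AllPairs (Step true) js × (∀ {j} → j ∈ js → j ∈ is) × a < length js) ⊎
             (AllPairs (Step false) js × b < length js)
  erdős–szekeres-list zero    b (i ∷ is) _ _ =
    i ∷ [] , inj₁ ([] ∷ [] , (λ { (here e) → here e }) , s≤s z≤n)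
  erdős–szekeres-list (suc a) b (i ∷ is) sorted@(_ ∷ is-sorted) p
    with rs , qs , mins , qs⊆ , dom , len ← running-minima i is sorted
    with m+n<k+l⇒m<k⊎n<l {b} {a * b} {suc (length rs)} (subst (b + a * b <_) (cong suc len) p)
  ... | inj₁ b< = i ∷ rs , inj₂ (mins , b<)
  ... | inj₂ ab< with erdős–szekeres-list a b qs (AllPairs-resp-⊆ qs⊆ is-sorted) ab<
  ... | js , inj₂ down = js , inj₂ down
  ... | j ∷ js , inj₁ (up@(j-up ∷ _) , js∈ , a<)
    with z , z∈ , s ← dom (js∈ (here refl))
    = z ∷ j ∷ js , inj₁ ((s ∷ All.map (Step-trans true s) j-up) ∷ up , mem , s≤s a<)
    where
    mem : ∀ {k} → k ∈ z ∷ j ∷ js → k ∈ i ∷ is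
    mem (here refl) = z∈
    mem (there k∈)  = there (Sub.lookup qs⊆ (js∈ k∈))

-- Enumeration of words and counting of the sparse ones.

vecs : List X → ∀ n → List (Vec X n)
vecs xs zero    = [] ∷ []
vecs xs (suc n) = cartesianProductWith _∷_ xs (vecs xs n)

length-cartesianProductWith : ∀ (f : X → Y → Z) xs ys →
  length (cartesianProductWith f xs ys) ≡ length xs * length ys
length-cartesianProductWith f []       ys = refl
length-cartesianProductWith f (x ∷ xs) ys =
  trans (length-++ (map (f x) ys)) (cong₂ _+_ (length-map (f x) ys) (length-cartesianProductWith f xs ys))

length-vecs : ∀ (xs : List X) n → length (vecs xs n) ≡ length xs ^ n
length-vecs xs zero    = refl
length-vecs xs (suc n) =
  trans (length-cartesianProductWith _∷_ xs (vecs xs n)) (cong (length xs *_) (length-vecs xs n))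

∈-vecs : ∀ {xs : List X} → (∀ x → x ∈ xs) → ∀ {n} (v : Vec X n) → v ∈ vecs xs n
∈-vecs all []      = here refl
∈-vecs all (x ∷ v) = ∈-cartesianProductWith⁺ _∷_ (all x) (∈-vecs all v)

Unique⇒length≤ : ∀ {xs ys : List X} → Unique xs → (∀ {x} → x ∈ xs → x ∈ ys) → length xs ≤ length ys
Unique⇒length≤ [] _ = z≤n
Unique⇒length≤ {xs = x ∷ xs} (x∉ ∷ unique) sub with ∈-∃++ (sub (here refl))
... | as , bs , refl = begin
  suc (length xs)              ≤⟨ s≤s (Unique⇒length≤ unique sub′) ⟩
  suc (length (as ++ bs))      ≡⟨ cong suc (length-++ as) ⟩
  suc (length as + length bs)  ≡⟨ +-suc (length as) (length bs) ⟨
  length as + suc (length bs)  ≡⟨ length-++ as ⟨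
  length (as ++ x ∷ bs)        ∎
  where
  open ≤-Reasoning
  sub′ : ∀ {z} → z ∈ xs → z ∈ as ++ bs
  sub′ z∈ with ∈-++⁻ as (sub (there z∈))
  ... | inj₁ z∈as         = ∈-++⁺ˡ z∈as
  ... | inj₂ (here refl)  = contradiction refl (All.lookup x∉ z∈)
  ... | inj₂ (there z∈bs) = ∈-++⁺ʳ as z∈bs

bools : List Bool
bools = true ∷ false ∷ []

∈-bools : ∀ b → b ∈ bools
∈-bools true  = here refl
∈-bools false = there (here refl)

letters : ∀ {H} → Vec (Maybe Z) H → List Z
letters []             = []
letters (nothing ∷ w)  = letters w
letters (just c ∷ w)   = c ∷ letters w

module _ (cs : List Z) where

  sparse : ∀ H → ℕ → List (Vec (Maybe Z) H)
  sparse zero    L       = [] ∷ []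
  sparse (suc H) zero    = map (nothing ∷_) (sparse H zero)
  sparse (suc H) (suc L) =
    map (nothing ∷_) (sparse H (suc L)) ++ cartesianProductWith (λ c w → just c ∷ w) cs (sparse H L)

  ∈-sparse : (∀ c → c ∈ cs) → ∀ {H} (w : Vec (Maybe Z) H) L → length (letters w) ≤ L → w ∈ sparse H L
  ∈-sparse all []            L       _       = here refl
  ∈-sparse all (nothing ∷ w) zero    p       = ∈-map⁺ (nothing ∷_) (∈-sparse all w zero p)
  ∈-sparse all (nothing ∷ w) (suc L) p       = ∈-++⁺ˡ (∈-map⁺ (nothing ∷_) (∈-sparse all w (suc L) p))
  ∈-sparse all (just c ∷ w)  (suc L) (s≤s p) =
    ∈-++⁺ʳ _ (∈-cartesianProductWith⁺ (λ c w → just c ∷ w) (all c) (∈-sparse all w L p))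

  -- With `r` letters, a word can be coded by `L` slots, each empty or holding a letter and its
  -- position: `1 + r * H` choices per slot. The induction on `H` reaches this bound without
  -- constructing the code.
  length-sparse : ∀ H L → length (sparse H L) ≤ suc (length cs * H) ^ L
  length-sparse zero    L       = m^n>0 (suc (length cs * 0)) L
  length-sparse (suc H) zero    = ≤-trans (≤-reflexive (length-map _ (sparse H zero))) (length-sparse H zero)
  length-sparse (suc H) (suc L) = begin
    length (map (nothing ∷_) (sparse H (suc L)) ++ rest)
      ≡⟨ length-++ (map (nothing ∷_) (sparse H (suc L))) ⟩
    length (map (nothing ∷_) (sparse H (suc L))) + length rest
      ≡⟨ cong₂ _+_ (length-map _ (sparse H (suc L))) (length-cartesianProductWith _ cs (sparse H L)) ⟩
    length (sparse H (suc L)) + r * length (sparse H L)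
      ≤⟨ +-mono-≤ (length-sparse H (suc L)) (*-monoʳ-≤ r (length-sparse H L)) ⟩
    suc (r * H) ^ suc L + r * suc (r * H) ^ L
      ≡⟨ *-distribʳ-+ (suc (r * H) ^ L) (suc (r * H)) r ⟨
    (suc (r * H) + r) * suc (r * H) ^ L
      ≡⟨ cong (_* suc (r * H) ^ L) (cong suc (trans (+-comm (r * H) r) (sym (*-suc r H)))) ⟩
    suc (r * suc H) * suc (r * H) ^ L
      ≤⟨ *-monoʳ-≤ (suc (r * suc H)) (^-monoˡ-≤ L (s≤s (*-monoʳ-≤ r (n≤1+n H)))) ⟩
    suc (r * suc H) ^ suc L ∎
    where
    open ≤-Reasoning
    r = length cs
    rest = cartesianProductWith (λ c w → just c ∷ w) cs (sparse H L)

-- Medians and separation in all rows at once.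

-- `v` decreases as long as at least `t` values are at most `v`. Where this stops, fewer than `t`
-- values lie strictly below `v`, so at least `t` lie at or above it; at `v = 0` all of them do.
median : ∀ (f : X → ℕ) t xs → t + t ≤ length xs →
         ∃ λ v → t ≤ length (filter (λ x → f x ≤? v) xs) × t ≤ length (filter (λ x → v ≤? f x) xs)
median f t xs 2t≤ = go bound
  (subst (t ≤_) (sym (cong length (filter-all (λ x → f x ≤? bound) (≤bound xs)))) t≤length)
  where
  low high : ℕ → ℕ
  low  v = length (filter (λ x → f x ≤? v) xs)
  high v = length (filter (λ x → v ≤? f x) xs)

  bound : ℕ
  -- Any upper bound for the values can start the descent; the sum is one.
  bound = sum (map f xs)

  ≤bound : ∀ ys → All (λ x → f x ≤ sum (map f ys)) ys
  ≤bound []       = []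
  ≤bound (y ∷ ys) = m≤m+n (f y) _ ∷ All.map (λ p → ≤-trans p (m≤n+m _ (f y))) (≤bound ys)

  t≤length : t ≤ length xs
  t≤length = m+n≤o⇒m≤o t 2t≤

  go : ∀ v → t ≤ low v → ∃ λ v → t ≤ low v × t ≤ high v
  go zero    p = 0 , p ,
    subst (t ≤_) (sym (cong length (filter-all (λ x → 0 ≤? f x) (All.universal (λ _ → z≤n) xs)))) t≤length
  go (suc v) p with t ≤? low v
  ... | yes q = go v q
  ... | no  q = suc v , p , +-cancelˡ-≤ t t (high (suc v)) (begin
    t + t                  ≤⟨ 2t≤ ⟩
    length xs              ≤⟨ length-filter-∁ (λ x → f x ≤? v) (λ x → suc v ≤? f x) (λ _ → ≰⇒>) xs ⟩
    low v + high (suc v)   ≤⟨ +-monoˡ-≤ _ (≰⇒≥ q) ⟩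
    t + high (suc v)       ∎)
    where open ≤-Reasoning

2*m*n≡m*n+m*n : ∀ m n → 2 * m * n ≡ m * n + m * n
2*m*n≡m*n+m*n = solve-∀

-- Comparing the medians of f on the two lists tells which halves to keep.
separate : ∀ (f : X → ℕ) t xs ys → t + t ≤ length xs → t + t ≤ length ys →
  ∃ λ b → ∃₂ λ as bs → as ⊆ xs × bs ⊆ ys × t ≤ length as × t ≤ length bs ×
    (∀ {x y} → x ∈ as → y ∈ bs → Dir b (f x) (f y))
separate f t xs ys px py with median f t xs px | median f t ys py
... | v , v-low , v-high | w , w-low , w-high with ≤-total v w
... | inj₁ v≤w = true , _ , _ , filter-⊆ (λ x → f x ≤? v) xs , filter-⊆ (λ y → w ≤? f y) ys
               , v-low , w-high
               , λ x∈ y∈ → ≤-trans (proj₂ (∈-filter⁻ (λ x → f x ≤? v) {xs = xs} x∈))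
                             (≤-trans v≤w (proj₂ (∈-filter⁻ (λ y → w ≤? f y) {xs = ys} y∈)))
... | inj₂ w≤v = false , _ , _ , filter-⊆ (λ x → v ≤? f x) xs , filter-⊆ (λ y → f y ≤? w) ys
               , v-high , w-low
               , λ x∈ y∈ → ≤-trans (proj₂ (∈-filter⁻ (λ y → f y ≤? w) {xs = ys} y∈))
                             (≤-trans w≤v (proj₂ (∈-filter⁻ (λ x → v ≤? f x) {xs = xs} x∈)))

-- The rows are treated one after another. Each costs a factor 2 in both lists, and the comparisons
-- already obtained survive the passage to sublists.
separate-all : ∀ q (f : Fin q → X → ℕ) t xs ys → 2 ^ q * t ≤ length xs → 2 ^ q * t ≤ length ys →
  ∃ λ (ε : Vec Bool q) → ∃₂ λ as bs → as ⊆ xs × bs ⊆ ys × t ≤ length as × t ≤ length bs ×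
    (∀ {x y} → x ∈ as → y ∈ bs → ∀ j → Dir (Vec.lookup ε j) (f j x) (f j y))
separate-all zero    f t xs ys px py =
  [] , xs , ys , ⊆-refl , ⊆-refl , subst (_≤ length xs) (+-identityʳ t) px
     , subst (_≤ length ys) (+-identityʳ t) py , λ _ _ ()
separate-all (suc q) f t xs ys px py
  with b , xs′ , ys′ , xs⊆ , ys⊆ , px′ , py′ , dir ←
         separate (f zero) (2 ^ q * t) xs ys
           (subst (_≤ length xs) (2*m*n≡m*n+m*n (2 ^ q) t) px)
           (subst (_≤ length ys) (2*m*n≡m*n+m*n (2 ^ q) t) py)
  with ε , as , bs , as⊆ , bs⊆ , pa , pb , dirs ← separate-all q (f ∘ suc) t xs′ ys′ px′ py′
  = b ∷ ε , as , bs , ⊆-trans as⊆ xs⊆ , ⊆-trans bs⊆ ys⊆ , pa , pb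
  , λ { x∈ y∈ zero → dir (Sub.lookup as⊆ x∈) (Sub.lookup bs⊆ y∈)
      ; x∈ y∈ (suc j) → dirs x∈ y∈ j }

-- Coloured binary trees of columns.

module _ {q N : ℕ} (f : Fin q → Fin N → ℕ) where

  Sep : Vec Bool q → Fin N → Fin N → Set
  Sep ε x y = x <ᶠ y × ∀ j → Dir (Vec.lookup ε j) (f j x) (f j y)

  -- Has εs xs: xs contains the leaves of a complete binary tree in which, for each node on
  -- level i, every left leaf is Sep (εs i)-related to every right leaf.
  Has : List (Vec Bool q) → List (Fin N) → Set
  Has []       xs = ∃ λ x → x ∈ xs
  Has (ε ∷ εs) xs = ∃₂ λ as bs → as ⊆ xs × bs ⊆ xs × Has εs as × Has εs bs ×
                      (∀ {x y} → x ∈ as → y ∈ bs → Sep ε x y)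

  Has-mono : ∀ εs {xs ys} → xs ⊆ ys → Has εs xs → Has εs ys
  Has-mono []       xs⊆ (x , x∈) = x , Sub.lookup xs⊆ x∈
  Has-mono (ε ∷ εs) xs⊆ (as , bs , as⊆ , bs⊆ , rest) =
    as , bs , ⊆-trans as⊆ xs⊆ , ⊆-trans bs⊆ xs⊆ , rest

  -- A level is deleted by keeping only the left subtree below each of its nodes.
  Has-drop : ∀ {εs δs} → δs ⊆ εs → ∀ {xs} → Has εs xs → Has δs xs
  Has-drop []               h = h
  Has-drop {δs = δs} (_ ∷ʳ p) (as , bs , as⊆ , bs⊆ , ha , hb , sep) = Has-mono δs as⊆ (Has-drop p ha)
  Has-drop (refl ∷ p) (as , bs , as⊆ , bs⊆ , ha , hb , sep) =
    as , bs , as⊆ , bs⊆ , Has-drop p ha , Has-drop p hb , sep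

  -- Cutting the sorted list by position puts all of `as` to the left of all of `bs`. This cut
  -- accounts for the one factor 2 beyond the `2 ^ q` lost in the rows.
  split : ∀ t xs → AllPairs _<ᶠ_ xs → 2 ^ suc q * t ≤ length xs →
    ∃ λ ε → ∃₂ λ as bs → as ⊆ xs × bs ⊆ xs × t ≤ length as × t ≤ length bs ×
      (∀ {x y} → x ∈ as → y ∈ bs → Sep ε x y)
  split t xs sorted p =
    let h    = 2 ^ q * t
        h+h≤ = subst (_≤ length xs) (2*m*n≡m*n+m*n (2 ^ q) t) p
        ε , as , bs , as⊆ , bs⊆ , pa , pb , dirs = separate-all q f t (take h xs) (drop h xs)
          (≤-reflexive (sym (trans (length-take h xs) (m≤n⇒m⊓n≡m (m+n≤o⇒m≤o h h+h≤)))))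
          (≤-trans (m+n≤o⇒m≤o∸n h h+h≤) (≤-reflexive (sym (length-drop h xs))))
    in ε , as , bs , ⊆-trans as⊆ (take-⊆ h xs) , ⊆-trans bs⊆ (drop-⊆ h xs) , pa , pb
     , λ x∈ y∈ → AllPairs-take-drop sorted h (Sub.lookup as⊆ x∈) (Sub.lookup bs⊆ y∈) , dirs x∈ y∈

  -- Pajor's argument: a word found on both sides yields, besides its copy with nothing in
  -- front, the new word with just ε in front.  Recording the depth of every letter is
  -- what makes the words with just ε in front new.
  shatter : ∀ H xs → AllPairs _<ᶠ_ xs → (2 ^ suc q) ^ H ≤ length xs →
    ∃ λ (ws : List (Vec (Maybe (Vec Bool q)) H)) →
      Unique ws × length ws ≡ 2 ^ H × (∀ {w} → w ∈ ws → Has (letters w) xs)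
  shatter zero    (x ∷ xs) _ _ = [] ∷ [] , [] ∷ [] , refl , λ { (here refl) → x , here refl }
  shatter (suc H) xs sorted p
    with ε , as , bs , as⊆ , bs⊆ , pa , pb , sep ← split ((2 ^ suc q) ^ H) xs sorted p
    with us , us! , |us| , has-us ← shatter H as (AllPairs-resp-⊆ as⊆ sorted) pa
       | vs , vs! , |vs| , has-vs ← shatter H bs (AllPairs-resp-⊆ bs⊆ sorted) pb
    = map (nothing ∷_) us ++ map extend vs
    , Unique.++⁺ (Unique.map⁺ (proj₂ ∘ Vec.∷-injective) us!) (Unique.map⁺ extend-injective vs!) disjoint
    , trans (length-++ (map (nothing ∷_) us))
        (cong₂ _+_ (trans (length-map _ us) |us|)
                   (trans (length-map _ vs) (trans |vs| (sym (+-identityʳ (2 ^ H))))))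
    , λ w∈ → [ has-left ∘ ∈-map⁻ (nothing ∷_) , has-right ∘ ∈-map⁻ extend ]′ (∈-++⁻ (map (nothing ∷_) us) w∈)
    where
    W : Set
    W = Vec (Maybe (Vec Bool q)) H

    open DecMembership (Vec.≡-dec {n = H} (Maybe.≡-dec (Vec.≡-dec {n = q} Bool._≟_))) using (_∈?_)

    first : ∀ {w : W} → Dec (w ∈ us) → Maybe (Vec Bool q)
    first (yes _) = just ε
    first (no _)  = nothing

    extend : W → Vec (Maybe (Vec Bool q)) (suc H)
    extend w = first (w ∈? us) ∷ w

    extend-injective : ∀ {v w} → extend v ≡ extend w → v ≡ w
    extend-injective = proj₂ ∘ Vec.∷-injective

    disjoint : Disjoint (map (nothing ∷_) us) (map extend vs)
    disjoint (∈l , ∈r) with ∈-map⁻ (nothing ∷_) ∈l | ∈-map⁻ extend ∈r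
    ... | u , u∈ , refl | v , _ , eq with v ∈? us | Vec.∷-injective eq
    ... | yes _  | () , _
    ... | no v∉  | _ , refl = v∉ u∈

    has-left : ∀ {w} → (∃ λ u → u ∈ us × w ≡ nothing ∷ u) → Has (letters w) xs
    has-left (u , u∈ , refl) = Has-mono (letters u) as⊆ (has-us u∈)

    has-right : ∀ {w} → (∃ λ v → v ∈ vs × w ≡ extend v) → Has (letters w) xs
    has-right (v , v∈ , refl) with v ∈? us
    ... | yes v∈us = as , bs , as⊆ , bs⊆ , has-us v∈us , has-vs v∈ , sep
    ... | no _     = Has-mono (letters v) bs⊆ (has-vs v∈)

  -- If all `2 ^ H` distinct words from `shatter` had at most `L` letters, they would fit into
  -- `sparse`, which the hypothesis makes too small.
  deep : ∀ H L xs → AllPairs _<ᶠ_ xs → (2 ^ suc q) ^ H ≤ length xs → suc (2 ^ q * H) ^ L < 2 ^ H →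
         ∃ λ εs → L < length εs × Has εs xs
  deep H L xs sorted p small with ws , ws! , |ws| , has ← shatter H xs sorted p
    with any? (λ w → L <? length (letters w)) ws
  ... | yes w∈ with w , w∈ws , deep-w ← find w∈ = letters w , deep-w , has w∈ws
  ... | no  shallow = contradiction small (≤⇒≯ (begin
    2 ^ H                                    ≡⟨ |ws| ⟨
    length ws                                ≤⟨ Unique⇒length≤ ws! (λ {w} w∈ →
                                                  ∈-sparse signs ∈-signs w L (≮⇒≥ (shallow ∘ lose w∈))) ⟩
    length (sparse signs H L)                ≤⟨ length-sparse signs H L ⟩
    suc (length signs * H) ^ L               ≡⟨ cong (λ r → suc (r * H) ^ L) (length-vecs bools q) ⟩
    suc (2 ^ q * H) ^ L                      ∎))
    where
    open ≤-Reasoning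
    signs : List (Vec Bool q)
    signs = vecs bools q
    ∈-signs : ∀ ε → ε ∈ signs
    ∈-signs = ∈-vecs ∈-bools

-- Estimates for binomial coefficients.

C-mono-≤ : ∀ k {m n} → m ≤ n → m C k ≤ n C k
C-mono-≤ k {n = n} p = go k (≤⇒≤′ p)
  where
  step : ∀ k n → n C k ≤ suc n C k
  step zero    n = ≤-refl
  step (suc k) n = ≤-trans (m≤n+m (n C suc k) (n C k)) (≤-reflexive (nCk+nC[k+1]≡[n+1]C[k+1] n k))
  go : ∀ k {m n} → m ≤′ n → m C k ≤ n C k
  go k ≤′-refl     = ≤-refl
  go k (≤′-step p) = ≤-trans (go k p) (step k _)

C>0 : ∀ {k n} → k ≤ n → 0 < n C k
C>0 {zero}  {n}     _       = s≤s z≤n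
C>0 {suc k} {suc n} (s≤s p) =
  ≤-trans (C>0 p) (≤-trans (m≤m+n (n C k) _) (≤-reflexive (nCk+nC[k+1]≡[n+1]C[k+1] n k)))

-- (k+1) C(n,k+1) = (n−k) C(n,k), with both sides moved so that no subtraction occurs.
absorb : ∀ n k → suc k * (n C suc k) + k * (n C k) ≡ n * (n C k)
absorb zero    zero    = refl
absorb zero    (suc k) = cong₂ _+_ (*-zeroʳ (suc (suc k))) (*-zeroʳ (suc k))
absorb (suc n) zero    = begin-equality
  1 * (suc n C 1) + 0    ≡⟨ cong (λ c → 1 * c + 0) (nCk+nC[k+1]≡[n+1]C[k+1] n 0) ⟨
  1 * (1 + n C 1) + 0    ≡⟨ lem (n C 1) ⟩
  1 + (1 * (n C 1) + 0)  ≡⟨ cong (1 +_) (absorb n 0) ⟩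
  suc n * 1              ∎
  where
  open ≤-Reasoning
  lem : ∀ x → 1 * (1 + x) + 0 ≡ 1 + (1 * x + 0)
  lem = solve-∀
absorb (suc n) (suc k) = begin-equality
  suc (suc k) * (suc n C suc (suc k)) + suc k * (suc n C suc k)
    ≡⟨ cong₂ (λ x y → suc (suc k) * x + suc k * y)
         (nCk+nC[k+1]≡[n+1]C[k+1] n (suc k)) (nCk+nC[k+1]≡[n+1]C[k+1] n k) ⟨
  suc (suc k) * (b + c) + suc k * (a + b)
    ≡⟨ lem₁ k a b c ⟩
  (suc (suc k) * c + suc k * b) + (suc k * b + k * a) + (a + b)
    ≡⟨ cong₂ (λ x y → x + y + (a + b)) (absorb n (suc k)) (absorb n k) ⟩
  n * b + n * a + (a + b)
    ≡⟨ lem₂ n a b ⟩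
  suc n * (a + b)
    ≡⟨ cong (suc n *_) (nCk+nC[k+1]≡[n+1]C[k+1] n k) ⟩
  suc n * (suc n C suc k) ∎
  where
  open ≤-Reasoning
  a = n C k
  b = n C suc k
  c = n C suc (suc k)
  lem₁ : ∀ k a b c → suc (suc k) * (b + c) + suc k * (a + b) ≡
                     (suc (suc k) * c + suc k * b) + (suc k * b + k * a) + (a + b)
  lem₁ = solve-∀
  lem₂ : ∀ n a b → n * b + n * a + (a + b) ≡ suc n * (a + b)
  lem₂ = solve-∀

-- The quotient of the two binomial coefficients is the product of the fractions (m - i)/(r + s - i)
-- for i < k. Each numerator is at most m, and each denominator at least r because i < k ≤ s.
C-ratio : ∀ m r s k → k ≤ s → (m C k) * r ^ k ≤ m ^ k * ((r + s) C k)
C-ratio m r s zero    _   = ≤-refl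
C-ratio m r s (suc k) k<s = *-cancelˡ-≤ (suc k) (begin
  suc k * ((m C suc k) * (r * r ^ k))
    ≡⟨ lem₁ (suc k) (m C suc k) r (r ^ k) ⟩
  (suc k * (m C suc k)) * r ^ k * r
    ≤⟨ *-monoˡ-≤ r (*-monoˡ-≤ (r ^ k) upper) ⟩
  (m * (m C k)) * r ^ k * r
    ≡⟨ cong (_* r) (*-assoc m (m C k) (r ^ k)) ⟩
  m * ((m C k) * r ^ k) * r
    ≤⟨ *-monoˡ-≤ r (*-monoʳ-≤ m (C-ratio m r s k (<⇒≤ k<s))) ⟩
  m * (m ^ k * ((r + s) C k)) * r
    ≡⟨ lem₂ m (m ^ k) ((r + s) C k) r ⟩
  m * m ^ k * (r * ((r + s) C k))
    ≤⟨ *-monoʳ-≤ (m * m ^ k) lower ⟩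
  m * m ^ k * (suc k * ((r + s) C suc k))
    ≡⟨ lem₃ (m * m ^ k) (suc k) ((r + s) C suc k) ⟩
  suc k * (m * m ^ k * ((r + s) C suc k)) ∎)
  where
  open ≤-Reasoning
  lem₁ : ∀ a b c d → a * (b * (c * d)) ≡ a * b * d * c
  lem₁ = solve-∀
  lem₂ : ∀ a b c d → a * (b * c) * d ≡ a * b * (d * c)
  lem₂ = solve-∀
  lem₃ : ∀ a b c → a * (b * c) ≡ b * (a * c)
  lem₃ = solve-∀
  upper : suc k * (m C suc k) ≤ m * (m C k)
  upper = ≤-trans (m≤m+n _ (k * (m C k))) (≤-reflexive (absorb m k))
  c = (r + s) C k
  lower : r * c ≤ suc k * ((r + s) C suc k)
  lower = +-cancelʳ-≤ (k * c) _ _ (begin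
    r * c + k * c                             ≤⟨ +-monoʳ-≤ (r * c) (*-monoˡ-≤ c (<⇒≤ k<s)) ⟩
    r * c + s * c                             ≡⟨ *-distribʳ-+ c r s ⟨
    (r + s) * c                               ≡⟨ absorb (r + s) k ⟨
    suc k * ((r + s) C suc k) + k * c         ∎)

-- Bernoulli's inequality (1 - 1/(p+1))^j ≥ 1 - j/(p+1), multiplied by (p+1)^(j+1) and rearranged to
-- avoid subtraction.
bernoulli : ∀ p j → suc p ^ suc j ≤ suc p * p ^ j + j * suc p ^ j
bernoulli p zero    = ≤-reflexive (sym (+-identityʳ _))
bernoulli p (suc j) = begin
  suc p * suc p ^ suc j
    ≤⟨ *-monoʳ-≤ (suc p) (bernoulli p j) ⟩
  suc p * (suc p * p ^ j + j * suc p ^ j)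
    ≡⟨ lem p j (p ^ j) (suc p ^ j) ⟩
  suc p * (p * p ^ j) + (suc p * p ^ j + j * (suc p * suc p ^ j))
    ≤⟨ +-monoʳ-≤ (suc p * (p * p ^ j)) (+-monoˡ-≤ _ (*-monoʳ-≤ (suc p) (^-monoˡ-≤ j (n≤1+n p)))) ⟩
  suc p * (p * p ^ j) + (suc p * suc p ^ j + j * (suc p * suc p ^ j)) ∎
  where
  open ≤-Reasoning
  lem : ∀ p j x y → suc p * (suc p * x + j * y) ≡ suc p * (p * x) + (suc p * x + j * (suc p * y))
  lem = solve-∀

^-distribʳ-* : ∀ m n k → (m * n) ^ k ≡ m ^ k * n ^ k
^-distribʳ-* m n zero    = refl
^-distribʳ-* m n (suc k) = trans (cong (m * n *_) (^-distribʳ-* m n k)) (lem m n (m ^ k) (n ^ k))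
  where
  lem : ∀ a b c d → a * b * (c * d) ≡ a * c * (b * d)
  lem = solve-∀

-- For h = 2k², `C-ratio` with r = h - k = k(2k - 1) and s = k bounds the quotient by 2^k (2k/(2k -
-- 1))^k. The last factor is at most 2, since (1 - 1/(2k))^k ≥ 1/2 by `bernoulli`.
C-halving : ∀ k → 0 < k → (2 * (2 * (k * k))) C k ≤ 2 * 2 ^ k * ((2 * (k * k)) C k)
C-halving (suc i) _ = *-cancelʳ-≤ _ _ (r ^ k) {{m^n≢0 r k}} (begin
  ((2 * h) C k) * r ^ k
    ≤⟨ C-ratio (2 * h) r k k ≤-refl ⟩
  (2 * h) ^ k * ((r + k) C k)
    ≡⟨ cong₂ (λ x y → x * (y C k)) (trans (cong (_^ k) h-eq) (trans (^-distribʳ-* (2 * k) (suc p) k)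
         (cong (_* suc p ^ k) (^-distribʳ-* 2 k k)))) r+k≡h ⟩
  2 ^ k * k ^ k * suc p ^ k * (h C k)
    ≤⟨ *-monoˡ-≤ (h C k) (*-monoʳ-≤ (2 ^ k * k ^ k) half) ⟩
  2 ^ k * k ^ k * (2 * p ^ k) * (h C k)
    ≡⟨ lem (2 ^ k) (k ^ k) (p ^ k) (h C k) ⟩
  2 * 2 ^ k * (h C k) * (k ^ k * p ^ k)
    ≡⟨ cong (2 * 2 ^ k * (h C k) *_) (^-distribʳ-* k p k) ⟨
  2 * 2 ^ k * (h C k) * r ^ k ∎)
  where
  open ≤-Reasoning
  k = suc i
  h = 2 * (k * k)
  p = suc (2 * i)
  r = k * p
  lem : ∀ a b c d → a * b * (2 * c) * d ≡ 2 * a * d * (b * c)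
  lem = solve-∀
  suc-p : suc p ≡ 2 * k
  suc-p = lem′ i
    where
    lem′ : ∀ i → suc (suc (2 * i)) ≡ 2 * suc i
    lem′ = solve-∀
  h-eq : 2 * h ≡ 2 * k * suc p
  h-eq = trans (lem′ k) (cong (2 * k *_) (sym suc-p))
    where
    lem′ : ∀ k → 2 * (2 * (k * k)) ≡ 2 * k * (2 * k)
    lem′ = solve-∀
  r+k≡h : r + k ≡ h
  r+k≡h = trans (lem′ k p) (trans (cong (k *_) suc-p) (lem″ k))
    where
    lem′ : ∀ k p → k * p + k ≡ k * suc p
    lem′ = solve-∀
    lem″ : ∀ k → k * (2 * k) ≡ 2 * (k * k)
    lem″ = solve-∀
  half : suc p ^ k ≤ 2 * p ^ k
  half = *-cancelˡ-≤ k (+-cancelʳ-≤ (k * suc p ^ k) _ _ (begin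
    k * suc p ^ k + k * suc p ^ k          ≡⟨ lem′ k (suc p ^ k) ⟩
    2 * k * suc p ^ k                      ≡⟨ cong (_* suc p ^ k) suc-p ⟨
    suc p ^ suc k                          ≤⟨ bernoulli p k ⟩
    suc p * p ^ k + k * suc p ^ k          ≡⟨ cong (λ x → x * p ^ k + k * suc p ^ k) suc-p ⟩
    2 * k * p ^ k + k * suc p ^ k          ≡⟨ cong (_+ k * suc p ^ k) (lem″ k (p ^ k)) ⟩
    k * (2 * p ^ k) + k * suc p ^ k        ∎))
    where
    lem′ : ∀ k x → k * x + k * x ≡ 2 * k * x
    lem′ = solve-∀
    lem″ : ∀ k x → 2 * k * x ≡ k * (2 * x)
    lem″ = solve-∀

-- Averaging over sets of levels.

count : ∀ {q} → Bool → List (Vec Bool q) → Fin q → ℕ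
count σ εs j = length (filter (λ ε → Vec.lookup ε j Bool.≟ σ) εs)

*-C-suc : ∀ s n k → s * (suc n C suc k) ≡ s * (n C suc k) + s * (n C k)
*-C-suc s n k = trans (cong (s *_) (trans (sym (nCk+nC[k+1]≡[n+1]C[k+1] n k)) (+-comm (n C k) _)))
                      (*-distribˡ-+ s (n C suc k) (n C k))

-- Only rows in which `ε` has sign `σ` gain in `count`; there Pascal's rule splits the binomial
-- coefficient.
sum-C-count : ∀ {q} σ (ε : Vec Bool q) εs k js →
  sum (map (λ j → count σ (ε ∷ εs) j C suc k) js) ≡
  sum (map (λ j → count σ εs j C suc k) js) +
    sum (map (λ j → count σ εs j C k) (filter (λ j → Vec.lookup ε j Bool.≟ σ) js))
sum-C-count σ ε εs k []       = refl
sum-C-count σ ε εs k (j ∷ js) with Vec.lookup ε j Bool.≟ σ | sum-C-count σ ε εs k js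
... | no _  | ih = trans (cong (count σ εs j C suc k +_) ih) (sym (+-assoc (count σ εs j C suc k) _ _))
... | yes _ | ih = trans (cong₂ _+_ (sym (nCk+nC[k+1]≡[n+1]C[k+1] (count σ εs j) k)) ih)
                     (lem (count σ εs j C k) (count σ εs j C suc k) _ _)
  where
  lem : ∀ a b c d → a + b + (c + d) ≡ b + c + (a + d)
  lem = solve-∀

-- Averaging over all k-element sublists δs of εs; Pascal's rule splits both sides of the
-- inequality according to whether δs uses the head of εs.
select : ∀ {q} σ (εs : List (Vec Bool q)) k s js →
  s * (length εs C k) < sum (map (λ j → count σ εs j C k) js) →
  ∃₂ λ δs is → δs ⊆ εs × is ⊆ js × length δs ≡ k × s < length is ×
    (∀ {j} → j ∈ is → All (λ ε → Vec.lookup ε j ≡ σ) δs)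
select σ εs       zero    s js p =
  [] , js , Sub.minimum εs , ⊆-refl , refl , subst₂ _<_ (*-identityʳ s) (ones js) p , λ _ → []
  where
  ones : ∀ js → sum (map (λ j → count σ εs j C 0) js) ≡ length js
  ones []       = refl
  ones (_ ∷ js) = cong suc (ones js)
select σ []       (suc k) s js p = contradiction (subst (s * 0 <_) (zeros js) p) λ ()
  where
  zeros : ∀ js → sum (map (λ j → count σ [] j C suc k) js) ≡ 0
  zeros []       = refl
  zeros (_ ∷ js) = zeros js
select {q} σ (ε ∷ εs) (suc k) s js p
  with m+n<k+l⇒m<k⊎n<l (subst₂ _<_ (*-C-suc s (length εs) k) (sum-C-count σ ε εs k js) p)
... | inj₁ skip
  with δs , is , δs⊆ , is⊆ , |δs| , s< , mono ← select σ εs (suc k) s js skip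
  = δs , is , ε ∷ʳ δs⊆ , is⊆ , |δs| , s< , mono
... | inj₂ keep
  with δs , is , δs⊆ , is⊆ , |δs| , s< , mono ←
         select σ εs k s (filter (λ j → Vec.lookup ε j Bool.≟ σ) js) keep
  = ε ∷ δs , is , refl ∷ δs⊆ , ⊆-trans is⊆ (filter-⊆ _ js) , cong suc |δs| , s<
  , λ j∈ → proj₂ (∈-filter⁻ (λ j → Vec.lookup ε j Bool.≟ σ) {xs = js} (Sub.lookup is⊆ j∈)) ∷ mono j∈

-- In each row one of the two signs occurs on at least `h` levels, so its binomial coefficient alone
-- is at least `h C k`.
majority : ∀ {q} (εs : List (Vec Bool q)) h k → 2 * h ≤ length εs → ∀ js →
  length js * (h C k) ≤ sum (map (λ j → count true εs j C k) js) + sum (map (λ j → count false εs j C k) js)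
majority εs h k p []       = z≤n
majority εs h k p (j ∷ js) = begin
  h C k + length js * (h C k)
    ≤⟨ +-mono-≤ one (majority εs h k p js) ⟩
  (count true εs j C k + count false εs j C k) + _
    ≡⟨ lem (count true εs j C k) _ _ _ ⟩
  (count true εs j C k + sum (map (λ j → count true εs j C k) js)) +
    (count false εs j C k + sum (map (λ j → count false εs j C k) js)) ∎
  where
  open ≤-Reasoning
  lem : ∀ a b c d → a + b + (c + d) ≡ a + c + (b + d)
  lem = solve-∀
  other : ∀ b → ¬ (b ≡ true) → b ≡ false
  other true  b≢ = contradiction refl b≢
  other false _  = refl
  total : 2 * h ≤ count true εs j + count false εs j
  total = ≤-trans p (length-filter-∁ _ (λ ε → Vec.lookup ε j Bool.≟ false) (λ ε → other (Vec.lookup ε j)) εs)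
  one : h C k ≤ count true εs j C k + count false εs j C k
  one with h ≤? count true εs j
  ... | yes h≤ = ≤-trans (C-mono-≤ k h≤) (m≤m+n _ _)
  ... | no  h≰ = ≤-trans (C-mono-≤ k (+-cancelˡ-≤ h h _ (begin
    h + h                                   ≡⟨ cong (h +_) (+-identityʳ h) ⟨
    2 * h                                   ≤⟨ total ⟩
    count true εs j + count false εs j      ≤⟨ +-monoˡ-≤ _ (≰⇒≥ h≰) ⟩
    h + count false εs j                    ∎))) (m≤n+m _ _)

module _ {q N : ℕ} (f : Fin q → Fin N → ℕ) where

  -- Two leaves are compared at the node where their paths part. When row `j` has sign `σ` on every
  -- level, all these comparisons agree.
  leaves : ∀ σ (js : List (Fin q)) εs xs → (∀ {j} → j ∈ js → All (λ ε → Vec.lookup ε j ≡ σ) εs) →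
    Has f εs xs → ∃ λ ys → (∀ {y} → y ∈ ys → y ∈ xs) × length ys ≡ 2 ^ length εs ×
      AllPairs (λ x y → x <ᶠ y × ∀ {j} → j ∈ js → Dir σ (f j x) (f j y)) ys
  leaves σ js []       xs const (x , x∈) = x ∷ [] , (λ { (here refl) → x∈ }) , refl , [] ∷ []
  leaves σ js (ε ∷ εs) xs const (as , bs , as⊆ , bs⊆ , has-a , has-b , sep)
    with ys , ys∈ , |ys| , inc-ys ← leaves σ js εs as (All.tail ∘ const) has-a
       | zs , zs∈ , |zs| , inc-zs ← leaves σ js εs bs (All.tail ∘ const) has-b
    = ys ++ zs
    , (λ y∈ → [ Sub.lookup as⊆ ∘ ys∈ , Sub.lookup bs⊆ ∘ zs∈ ]′ (∈-++⁻ ys y∈))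
    , trans (length-++ ys) (cong₂ _+_ |ys| (trans |zs| (sym (+-identityʳ _))))
    , AllPairs.++⁺ inc-ys inc-zs (All.tabulate λ y∈ → All.tabulate λ z∈ →
        let y<z , dir = sep (ys∈ y∈) (zs∈ z∈) in
        y<z , λ {j} j∈ → subst (λ b → Dir b (f j _) (f j _)) (All.head (const j∈)) (dir j))

-- Logarithms and the size of the word count.

n<2^n : ∀ n → n < 2 ^ n
n<2^n zero    = s≤s z≤n
n<2^n (suc n) = begin
  2 + n               ≤⟨ +-mono-≤ (m^n>0 2 n) (n<2^n n) ⟩
  2 ^ n + 2 ^ n       ≡⟨ cong (2 ^ n +_) (+-identityʳ (2 ^ n)) ⟨
  2 * 2 ^ n           ∎
  where open ≤-Reasoning

n≤2*⌈n/2⌉ : ∀ n → n ≤ 2 * ⌈ n /2⌉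
n≤2*⌈n/2⌉ n = begin
  n                         ≡⟨ ⌊n/2⌋+⌈n/2⌉≡n n ⟨
  ⌊ n /2⌋ + ⌈ n /2⌉         ≤⟨ +-monoˡ-≤ ⌈ n /2⌉ (⌊n/2⌋≤⌈n/2⌉ n) ⟩
  ⌈ n /2⌉ + ⌈ n /2⌉         ≡⟨ cong (⌈ n /2⌉ +_) (+-identityʳ ⌈ n /2⌉) ⟨
  2 * ⌈ n /2⌉               ∎
  where open ≤-Reasoning

⌈log₂⌉>0 : ∀ {n} → 2 ≤ n → 0 < ⌈log₂ n ⌉
⌈log₂⌉>0 = ⌈log₂⌉-mono-≤

n≤2^⌈log₂n⌉ : ∀ n → n ≤ 2 ^ ⌈log₂ n ⌉
n≤2^⌈log₂n⌉ = <-rec _ go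
  where
  open ≤-Reasoning
  go : ∀ n → (∀ {m} → m < n → m ≤ 2 ^ ⌈log₂ m ⌉) → n ≤ 2 ^ ⌈log₂ n ⌉
  go 0 _ = z≤n
  go 1 _ = s≤s z≤n
  go n@(suc (suc i)) ih = begin
    n                                ≤⟨ n≤2*⌈n/2⌉ n ⟩
    2 * ⌈ n /2⌉                      ≤⟨ *-monoʳ-≤ 2 (ih (⌈n/2⌉<n i)) ⟩
    2 * 2 ^ ⌈log₂ ⌈ n /2⌉ ⌉          ≡⟨ cong (λ k → 2 * 2 ^ k) (⌈log₂⌈n/2⌉⌉≡⌈log₂n⌉∸1 n) ⟩
    2 ^ suc (⌈log₂ n ⌉ ∸ 1) ≡⟨ cong (2 ^_) (m+[n∸m]≡n (⌈log₂⌉>0 {n} (s≤s (s≤s z≤n)))) ⟩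
    2 ^ ⌈log₂ n ⌉                    ∎

-- Taking logarithms in the opposite inequality would give `k + 1 ≤ k` for `k = ⌈log₂ n ⌉`.
2^⌈log₂n⌉<2n : ∀ n .{{_ : NonZero n}} → 2 ^ ⌈log₂ n ⌉ < 2 * n
2^⌈log₂n⌉<2n n = ≰⇒> λ p → n≮n ⌈log₂ n ⌉
  (subst₂ _≤_ (⌈log₂2*n⌉≡1+⌈log₂n⌉ n) (⌈log₂2^n⌉≡n ⌈log₂ n ⌉) (⌈log₂⌉-mono-≤ p))

-- The depth `5 * q * L` is chosen so that the base on the left is at most `2 ^ (4 * q)`; then
-- `4 * q * L` stays below `5 * q * L`.
sparse-words-bound : ∀ q L → 4 ≤ q → 0 < L → L ≤ 2 * q → suc (2 ^ q * (5 * q * L)) ^ L < 2 ^ (5 * q * L)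
sparse-words-bound q L 4≤q 0<L L≤2q = begin-strict
  suc (2 ^ q * (5 * q * L)) ^ L      ≤⟨ ^-monoˡ-≤ L base ⟩
  (2 ^ (4 * q)) ^ L                  ≡⟨ ^-*-assoc 2 (4 * q) L ⟩
  2 ^ (4 * q * L)                    <⟨ ^-monoʳ-< 2 (s≤s (s≤s z≤n)) (*-monoˡ-< L {{>-nonZero 0<L}}
                                          (*-monoˡ-< q {{>-nonZero 0<q}} (n<1+n 4))) ⟩
  2 ^ (5 * q * L)                    ∎
  where
  open ≤-Reasoning
  0<q : 0 < q
  0<q = ≤-trans (s≤s z≤n) 4≤q
  lem₁ : ∀ a q → suc (a * (5 * q * (2 * q))) ≡ 1 + 10 * (a * q * q)
  lem₁ = solve-∀
  a = 2 ^ q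
  q≤ : q ≤ a
  q≤ = <⇒≤ (n<2^n q)
  base : suc (a * (5 * q * L)) ≤ 2 ^ (4 * q)
  base = begin
    suc (a * (5 * q * L))          ≤⟨ s≤s (*-monoʳ-≤ a (*-monoʳ-≤ (5 * q) L≤2q)) ⟩
    suc (a * (5 * q * (2 * q)))    ≡⟨ lem₁ a q ⟩
    -- Each `q` is traded for `a = 2 ^ q`. The resulting 11a³ is at most 16a³, and 16 ≤ a because 4
    -- ≤ q.
    1 + 10 * (a * q * q)           ≤⟨ +-mono-≤ (*-mono-≤ (*-mono-≤ (m^n>0 2 q) (m^n>0 2 q)) (m^n>0 2 q))
                                      (*-monoʳ-≤ 10 (*-mono-≤ (*-monoʳ-≤ a q≤) q≤)) ⟩
    a * a * a + 10 * (a * a * a)   ≤⟨ m≤m+n _ (5 * (a * a * a)) ⟩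
    a * a * a + 10 * (a * a * a) + 5 * (a * a * a)  ≡⟨ lem (a * a * a) ⟩
    16 * (a * a * a)               ≤⟨ *-monoˡ-≤ (a * a * a) (^-monoʳ-≤ 2 4≤q) ⟩
    a * (a * a * a)                ≡⟨ lem₄ a ⟩
    a ^ 4                          ≡⟨ ^-*-assoc 2 q 4 ⟩
    2 ^ (q * 4)                    ≡⟨ cong (2 ^_) (*-comm q 4) ⟩
    2 ^ (4 * q)                    ∎
    where
    lem : ∀ x → x + 10 * x + 5 * x ≡ 16 * x
    lem = solve-∀
    lem₄ : ∀ a → a * (a * a * a) ≡ a * (a * (a * (a * 1)))
    lem₄ = solve-∀

-- Rows and columns selected from a matrix of ranks.

Increasing : (X → X → Set) → ∀ {n} → (Fin n → X) → Set
Increasing R g = ∀ {i j} → i <ᶠ j → R (g i) (g j)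

choose : ∀ {R : Rel X 0ℓ} {xs n} → AllPairs R xs → n ≤ length xs →
         Σ[ g ∈ (Fin n → X) ] (Increasing R g × ∀ i → g i ∈ xs)
choose {xs = xs} pairs n≤ =
  (λ i → lookup xs (inject≤ i n≤)) ,
  (λ {i} {j} i<j → AllPairs-lookup pairs
     (subst₂ _<_ (sym (Fin.toℕ-inject≤ i n≤)) (sym (Fin.toℕ-inject≤ j n≤)) i<j)) ,
  λ i → ∈-lookup (inject≤ i n≤)

erdős–szekeres : ∀ {m} (x : Fin m → ℕ) q → 0 < q → q * q ≤ m →
  ∃ λ b → Σ[ g ∈ (Fin q → Fin m) ] Increasing (Step x b) g
erdős–szekeres {m} x (suc i) _ q²≤m
  -- Both parameters are `i = q - 1`, so "more than `i`" means at least `q`.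
  with erdős–szekeres-list x i i (allFin m) (AllPairs.tabulate⁺-< id)
         (≤-trans (*-mono-< (n<1+n i) (n<1+n i)) (≤-trans q²≤m
           (≤-reflexive (sym (length-tabulate {n = m} id)))))
... | js , inj₁ (up , _ , i<)  = let g , inc , _ = choose up i< in true , g , inc
... | js , inj₂ (down , i<)    = let g , inc , _ = choose down i< in false , g , inc

m+m<k+l⇒m<k⊎m<l : ∀ {m n k l} → m + m < n → n ≤ k + l → m < k ⊎ m < l
m+m<k+l⇒m<k⊎m<l p q = m+n<k+l⇒m<k⊎n<l (≤-trans p q)

-- The parameters are tied by equations rather than substituted, so that 2 ^ suc q never unfolds.
monotone-levels : ∀ {q n k h} (εs : List (Vec Bool q)) → q ≡ 8 * (n * n) → h ≡ 2 * (k * k) →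
  0 < n → 0 < k → 2 ^ k < 2 * n → length εs ≡ 2 * h →
  ∃ λ σ → ∃₂ λ δs js → δs ⊆ εs × js ⊆ allFin q × length δs ≡ k × n ≤ length js ×
    (∀ {j} → j ∈ js → All (λ ε → Vec.lookup ε j ≡ σ) δs)
monotone-levels {q} {n@(suc i)} {k} {h} εs q≡ h≡ _ 0<k 2^k< |εs| =
  [ (λ p → true , found true p) , (λ p → false , found false p) ]′
    (m+m<k+l⇒m<k⊎m<l {k = total true} {l = total false} few
      (majority εs h k (≤-reflexive (sym |εs|)) (allFin q)))
  where
  open ≤-Reasoning
  c = h C k

  total : Bool → ℕ
  total σ = sum (List.map (λ j → count σ εs j C k) (allFin q))

  -- The threshold is `i = n - 1`, since `select` returns more rows than the threshold.
  found : ∀ σ → i * ((2 * h) C k) < total σ → _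
  found σ p = select σ εs k i (allFin q) (subst (λ l → i * (l C k) < total σ) (sym |εs|) p)

  k≤h : k ≤ h
  k≤h = begin
    k             ≡⟨ *-identityʳ k ⟨
    k * 1         ≤⟨ *-monoʳ-≤ k 0<k ⟩
    k * k         ≤⟨ m≤n*m (k * k) 2 ⟩
    2 * (k * k)   ≡⟨ h≡ ⟨
    h             ∎

  ratio : (2 * h) C k ≤ 4 * n * c
  ratio = begin
    (2 * h) C k          ≤⟨ subst (λ h → (2 * h) C k ≤ 2 * 2 ^ k * (h C k)) (sym h≡) (C-halving k 0<k) ⟩
    2 * 2 ^ k * c        ≤⟨ *-monoˡ-≤ c (*-monoʳ-≤ 2 (<⇒≤ 2^k<)) ⟩
    2 * (2 * n) * c      ≡⟨ cong (_* c) (*-assoc 2 2 n) ⟨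
    4 * n * c            ∎

  lem₁ : ∀ i n c → i * (4 * n * c) + i * (4 * n * c) ≡ i * (8 * n * c)
  lem₁ = solve-∀
  lem₂ : ∀ n c → n * (8 * n * c) ≡ 8 * (n * n) * c
  lem₂ = solve-∀

  few : i * ((2 * h) C k) + i * ((2 * h) C k) < length (allFin q) * c
  -- The 8 in `q = 8n²` is the 4 of `ratio` times the two signs; passing from `i` to `n` makes the
  -- inequality strict.
  few = begin-strict
    i * ((2 * h) C k) + i * ((2 * h) C k)   ≤⟨ +-mono-≤ (*-monoʳ-≤ i ratio) (*-monoʳ-≤ i ratio) ⟩
    i * (4 * n * c) + i * (4 * n * c)       ≡⟨ lem₁ i n c ⟩
    i * (8 * n * c)                         <⟨ *-monoˡ-< (8 * n * c)
                                                 {{>-nonZero (*-mono-≤ {1} {8 * n} (s≤s z≤n) (C>0 k≤h))}} (n<1+n i) ⟩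
    n * (8 * n * c)                         ≡⟨ lem₂ n c ⟩
    8 * (n * n) * c                         ≡⟨ cong (_* c) q≡ ⟨
    q * c                                   ≡⟨ cong (_* c) (length-tabulate {n = q} id) ⟨
    length (allFin q) * c                   ∎

monotone-rows : ∀ {N n k q h H} → q ≡ 8 * (n * n) → h ≡ 2 * (k * k) → H ≡ 5 * q * (2 * h) →
  0 < n → 0 < k → n ≤ 2 ^ k → 2 ^ k < 2 * n →
  (f : Fin q → Fin N → ℕ) → ∀ xs → AllPairs _<ᶠ_ xs → (2 ^ suc q) ^ H ≤ length xs →
  ∃ λ σ → Σ[ r ∈ (Fin n → Fin q) ] Σ[ c ∈ (Fin n → Fin N) ]
    (Increasing _<ᶠ_ r × (∀ l → c l ∈ xs) ×
     Increasing (λ x y → x <ᶠ y × ∀ i → Dir σ (f (r i) x) (f (r i) y)) c)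
monotone-rows {N} {n} {k} {q} {h} {H} q≡ h≡ H≡ 0<n 0<k n≤ 2^k< f xs sorted p =
  let εs , L< , has = deep f H (2 * h) xs sorted p
        (subst (λ H → suc (2 ^ q * H) ^ (2 * h) < 2 ^ H) (sym H≡)
          (sparse-words-bound q (2 * h) 4≤q 0<2h 2h≤2q))
      -- `deep` gives more than `2 * h` levels. Exactly `2 * h` are kept, as the averaging compares
      -- `h C k` with `(2 * h) C k`; `Has-drop` then passes to the `k` selected ones.
      σ , δs , js , δs⊆ , js⊆ , |δs| , n≤js , const =
        monotone-levels (take (2 * h) εs) q≡ h≡ 0<n 0<k 2^k<
          (trans (length-take (2 * h) εs) (m≤n⇒m⊓n≡m (<⇒≤ L<)))
      ys , ys∈ , |ys| , ys-inc = leaves f σ js δs xs const (Has-drop f (Sub.⊆-trans δs⊆ (take-⊆ _ εs)) has)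
      r , r-inc , r∈ = choose (AllPairs-resp-⊆ js⊆ (AllPairs.tabulate⁺-< id)) n≤js
      c , c-inc , c∈ = choose ys-inc (≤-trans n≤ (≤-reflexive (sym (trans |ys| (cong (2 ^_) |δs|)))))
  in σ , r , c , r-inc , ys∈ ∘ c∈ , λ l<l′ → let c<c′ , dir = c-inc l<l′ in c<c′ , λ i → dir (r∈ i)
  where
  open ≤-Reasoning

  4≤q : 4 ≤ q
  4≤q = begin
    4               ≤⟨ *-mono-≤ {4} {8} (m≤m+n 4 4) (*-mono-≤ 0<n 0<n) ⟩
    8 * (n * n)     ≡⟨ q≡ ⟨
    q               ∎

  0<2h : 0 < 2 * h
  0<2h = begin
    1                    ≤⟨ *-mono-≤ {1} {2} (s≤s z≤n) (*-mono-≤ {1} {2} (s≤s z≤n) (*-mono-≤ 0<k 0<k)) ⟩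
    2 * (2 * (k * k))    ≡⟨ cong (2 *_) h≡ ⟨
    2 * h                ∎

  -- This crude bound on the logarithm already gives 4k² ≤ 16n² = 2q.
  k≤2n : k ≤ 2 * n
  k≤2n = <⇒≤ (<-trans (n<2^n k) 2^k<)

  lem : ∀ n → 2 * (2 * (2 * n * (2 * n))) ≡ 2 * (8 * (n * n))
  lem = solve-∀

  2h≤2q : 2 * h ≤ 2 * q
  2h≤2q = begin
    2 * h                              ≡⟨ cong (2 *_) h≡ ⟩
    2 * (2 * (k * k))                  ≤⟨ *-monoʳ-≤ 2 (*-monoʳ-≤ 2 (*-mono-≤ k≤2n k≤2n)) ⟩
    2 * (2 * (2 * n * (2 * n)))        ≡⟨ lem n ⟩
    2 * (8 * (n * n))                  ≡⟨ cong (2 *_) q≡ ⟨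
    2 * q                              ∎

module _ {m N} (q : ℕ) (0<q : 0 < q) (q²≤m : q * q ≤ m) (f : Fin m → Fin N → ℕ) where

  private
    es : ∀ x → ∃ λ b → Σ[ g ∈ (Fin q → Fin m) ] Increasing (Step (λ i → f i x) b) g
    es x = erdős–szekeres (λ i → f i x) q 0<q q²≤m

    -- The rows are stored as a vector, because the keys must be enumerable and have decidable
    -- equality.
    key : Fin N → Vec (Fin m) q × Bool
    key x = let b , g , _ = es x in Vec.tabulate g , b

    keys : List (Vec (Fin m) q × Bool)
    keys = cartesianProduct (vecs (allFin m) q) bools

    key-increasing : ∀ x → Increasing (Step (λ i → f i x) (proj₂ (key x))) (Vec.lookup (proj₁ (key x)))
    key-increasing x {i} {j} i<j =
      let b , g , inc = es x
      in subst₂ (Step (λ i → f i x) b) (sym (Vec.lookup∘tabulate g i))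
           (sym (Vec.lookup∘tabulate g j)) (inc i<j)

    |keys| : length keys ≡ m ^ q * 2
    |keys| = trans (length-cartesianProductWith _,_ (vecs (allFin m) q) bools)
      (cong (_* 2) (trans (length-vecs (allFin m) q) (cong (_^ q) (length-tabulate {n = m} id))))

  monotone-columns : ∀ t → m ^ q * 2 * t < N →
    ∃ λ τ → Σ[ g ∈ (Fin q → Fin m) ] ∃ λ xs → AllPairs _<ᶠ_ xs × t < length xs ×
      (∀ {x} → x ∈ xs → Increasing (Step (λ i → f i x) τ) g)
  monotone-columns t p =
    let (v , τ) , xs , xs⊆ , same , t< =
          pigeonhole (Product.≡-dec (Vec.≡-dec Fin._≟_) Bool._≟_) key keys (allFin N) t
            (λ {x} _ → ∈-cartesianProduct⁺ (∈-vecs ∈-allFin (proj₁ (key x))) (∈-bools (proj₂ (key x))))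
            (subst₂ _<_ (cong (_* t) (sym |keys|)) (sym (length-tabulate {n = N} id)) p)
    in τ , Vec.lookup v , xs , AllPairs-resp-⊆ xs⊆ (AllPairs.tabulate⁺-< id) , t<
     , λ {x} x∈ → subst (λ (v , τ) → Increasing (Step (λ i → f i x) τ) (Vec.lookup v)) (same x∈)
         (key-increasing x)

-- The pigeonhole step costs `m ^ q * 2`, where m = 64n⁴ = q² ≤ 2^(2q), and the tree of depth H =
-- 20qk² needs 2^((q+1)H) columns. The total exponent is of order q²k², and q² = 64n⁴ supplies the
-- factor 64.
columns-bound : ∀ {n k q h H N} → q ≡ 8 * (n * n) → h ≡ 2 * (k * k) → H ≡ 5 * q * (2 * h) →
  0 < n → 0 < k → 2 ^ (44 * 64 * n ^ 4 * k ^ 2) ≤ N → (64 * n ^ 4) ^ q * 2 * (2 ^ suc q) ^ H < N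
columns-bound {n} {k} {q} {h} {H} {N} q≡ h≡ H≡ 0<n 0<k N≥ = begin-strict
  (64 * n ^ 4) ^ q * 2 * (2 ^ suc q) ^ H
    ≤⟨ *-monoˡ-≤ _ (*-monoˡ-≤ 2 (^-monoˡ-≤ q m≤)) ⟩
  (2 ^ (q + q)) ^ q * 2 ^ 1 * (2 ^ suc q) ^ H
    ≡⟨ cong₂ (λ a b → a * 2 ^ 1 * b) (^-*-assoc 2 (q + q) q) (^-*-assoc 2 (suc q) H) ⟩
  2 ^ ((q + q) * q) * 2 ^ 1 * 2 ^ (suc q * H)
    ≡⟨ cong (_* 2 ^ (suc q * H)) (^-distribˡ-+-* 2 ((q + q) * q) 1) ⟨
  2 ^ ((q + q) * q + 1) * 2 ^ (suc q * H)
    ≡⟨ ^-distribˡ-+-* 2 ((q + q) * q + 1) (suc q * H) ⟨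
  2 ^ ((q + q) * q + 1 + suc q * H)
    <⟨ ^-monoʳ-< 2 (s≤s (s≤s z≤n)) exponent ⟩
  2 ^ (44 * 64 * n ^ 4 * k ^ 2)
    ≤⟨ N≥ ⟩
  N ∎
  where
  open ≤-Reasoning
  K = k * k

  q²≡ : q * q ≡ 64 * n ^ 4
  q²≡ = trans (cong₂ _*_ q≡ q≡) (lem n)
    where
    lem : ∀ n → 8 * (n * n) * (8 * (n * n)) ≡ 64 * (n * (n * (n * (n * 1))))
    lem = solve-∀

  m≤ : 64 * n ^ 4 ≤ 2 ^ (q + q)
  m≤ = begin
    64 * n ^ 4       ≡⟨ q²≡ ⟨
    q * q            ≤⟨ *-mono-≤ (<⇒≤ (n<2^n q)) (<⇒≤ (n<2^n q)) ⟩
    2 ^ q * 2 ^ q    ≡⟨ ^-distribˡ-+-* 2 q q ⟨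
    2 ^ (q + q)      ∎

  0<q : 0 < q
  0<q = subst (0 <_) (sym q≡) (*-mono-≤ {1} {8} (s≤s z≤n) (*-mono-≤ 0<n 0<n))

  0<K : 0 < K
  0<K = *-mono-≤ 0<k 0<k

  q²≤q²K : q * q * 1 ≤ q * q * K
  q²≤q²K = *-monoʳ-≤ (q * q) 0<K

  exponent : (q + q) * q + 1 + suc q * H < 44 * 64 * n ^ 4 * k ^ 2
  exponent = begin
    -- The outer `suc` expresses strictness. Bounding each term by a multiple of `q * q * K` gives 2
    -- + 2 + 20 + 20 = 44.
    suc ((q + q) * q + 1 + suc q * H)
      ≡⟨ cong (λ H → suc ((q + q) * q + 1 + suc q * H)) (trans H≡ (cong (λ h → 5 * q * (2 * h)) h≡)) ⟩
    suc ((q + q) * q + 1 + suc q * (5 * q * (2 * (2 * K))))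
      ≡⟨ lem₁ q K ⟩
    2 * (q * q * 1) + 2 * (1 * 1 * 1) + 20 * (q * q * K) + 20 * (1 * q * K)
      ≤⟨ +-mono-≤ (+-monoˡ-≤ (20 * (q * q * K)) (+-mono-≤ (*-monoʳ-≤ 2 q²≤q²K)
           (*-monoʳ-≤ 2 (*-mono-≤ (*-mono-≤ 0<q 0<q) 0<K))))
           (*-monoʳ-≤ 20 (*-monoˡ-≤ K (*-monoˡ-≤ q 0<q))) ⟩
    2 * (q * q * K) + 2 * (q * q * K) + 20 * (q * q * K) + 20 * (q * q * K)
      ≡⟨ lem₂ (q * q) K ⟩
    44 * (q * q) * K
      ≡⟨ cong (λ x → 44 * x * K) q²≡ ⟩
    44 * (64 * n ^ 4) * K
      ≡⟨ cong₂ _*_ (sym (*-assoc 44 64 (n ^ 4))) (cong (k *_) (sym (*-identityʳ k))) ⟩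
    44 * 64 * n ^ 4 * k ^ 2 ∎
    where
    lem₁ : ∀ q K → suc ((q + q) * q + 1 + suc q * (5 * q * (2 * (2 * K)))) ≡
                   2 * (q * q * 1) + 2 * (1 * 1 * 1) + 20 * (q * q * K) + 20 * (1 * q * K)
    lem₁ = solve-∀
    lem₂ : ∀ a K → 2 * (a * K) + 2 * (a * K) + 20 * (a * K) + 20 * (a * K) ≡ 44 * a * K
    lem₂ = solve-∀

-- Assembly for matrices over a total order.

module _ (O : TotalOrder 0ℓ 0ℓ 0ℓ) where
  open TotalOrder O using () renaming (_≤_ to _≼_)

  -- All entries are ranked as a single family, so that the same numbers serve for comparisons along
  -- rows and along columns.
  entry-ranks : ∀ {m N} (M : Matrix O m N) →
    Σ[ f ∈ (Fin m → Fin N → ℕ) ] (∀ {i j x y} → f i x ≤ f j y → M i x ≼ M j y)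
  entry-ranks {m} {N} M =
    let ρ , _ , reflects , _ = ranks O entry
    in (λ i x → ρ (combine i x)) , λ {i} {j} {x} {y} p →
      subst₂ _≼_ (entry-combine i x) (entry-combine j y) (reflects (combine i x) (combine j y) p)
    where
    entry : Fin (m * N) → TotalOrder.Carrier O
    entry p = let i , x = remQuot N p in M i x
    entry-combine : ∀ i x → entry (combine i x) ≡ M i x
    entry-combine i x = cong (λ (i , x) → M i x) (Fin.remQuot-combine i x)

  monotone-by-ranks : ∀ {n m N} (M : Matrix O m N) (f : Fin m → Fin N → ℕ) →
    (∀ {i j x y} → f i x ≤ f j y → M i x ≼ M j y) →
    (r : Fin n → Fin m) (c : Fin n → Fin N) → ∀ σ τ →
    (∀ k → Increasing (λ x y → Dir σ (f (r k) x) (f (r k) y)) c) →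
    (∀ l → Increasing (λ i j → Dir τ (f i (c l)) (f j (c l))) r) →
    MonotoneMatrix O (submatrix O M r c)
  monotone-by-ranks M f reflects r c σ τ rows cols = by-row σ rows , by-col τ cols
    where
    B = submatrix O M r c
    by-row : ∀ σ → (∀ k → Increasing (λ x y → Dir σ (f (r k) x) (f (r k) y)) c) →
             (∀ k → NonDecreasing O (B k)) ⊎ (∀ k → NonIncreasing O (B k))
    by-row true  rows = inj₁ λ k l<l′ → reflects (rows k l<l′)
    by-row false rows = inj₂ λ k l<l′ → reflects (rows k l<l′)
    by-col : ∀ τ → (∀ l → Increasing (λ i j → Dir τ (f i (c l)) (f j (c l))) r) →
             (∀ l → NonDecreasing O (λ k → B k l)) ⊎ (∀ l → NonIncreasing O (λ k → B k l))
    by-col true  cols = inj₁ λ l k<k′ → reflects (cols l k<k′)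
    by-col false cols = inj₂ λ l k<k′ → reflects (cols l k<k′)

  large-case : ∀ {m N n k q h H} → q ≡ 8 * (n * n) → h ≡ 2 * (k * k) → H ≡ 5 * q * (2 * h) →
    0 < n → 0 < k → n ≤ 2 ^ k → 2 ^ k < 2 * n → q * q ≤ m → m ^ q * 2 * (2 ^ suc q) ^ H < N →
    (M : Matrix O m N) → HasMonotoneSubmatrix O n M
  large-case {m} {N} {n} {k} {q} {h} {H} q≡ h≡ H≡ 0<n 0<k n≤ 2^k< q²≤m N> M =
    let f , reflects = entry-ranks M
        τ , g , xs , sorted , large , cols = monotone-columns q 0<q q²≤m f ((2 ^ suc q) ^ H) N>
        σ , r , c , r-inc , c∈ , rows =
          -- `f ∘ g` restricts the ranks to the `q` rows from the pigeonhole step; choosing rows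
          -- among them by `r` preserves the column type `τ`.
          monotone-rows q≡ h≡ H≡ 0<n 0<k n≤ 2^k< (f ∘ g) xs sorted (<⇒≤ large)
    in g ∘ r , c
     , (λ {i} i<j → proj₁ (cols (c∈ i) (r-inc i<j)))
     , (λ i<j → proj₁ (rows i<j))
     , monotone-by-ranks M f reflects (g ∘ r) c σ τ
         (λ k l<l′ → proj₂ (rows l<l′) k)
         (λ l k<k′ → proj₂ (cols (c∈ l) (r-inc k<k′)))
    where
    0<q : 0 < q
    0<q = subst (0 <_) (sym q≡) (*-mono-≤ {1} {8} (s≤s z≤n) (*-mono-≤ 0<n 0<n))

  unit-case : ∀ {m N} → 0 < m → 0 < N → (M : Matrix O m N) → HasMonotoneSubmatrix O 1 M
  unit-case 0<m 0<N M =
    (λ _ → fromℕ< 0<m) , (λ _ → fromℕ< 0<N)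
    , (λ { {zero} {zero} () }) , (λ { {zero} {zero} () })
    , inj₁ (λ { _ {zero} {zero} () }) , inj₁ (λ { _ {zero} {zero} () })

theorem5 : Σ[ c₀ ∈ ℕ ] (c₀ ≥ 1 ×
    ((O : TotalOrder 0ℓ 0ℓ 0ℓ) → (n : ℕ) → n ≥ 1 → (N : ℕ) →
    2 ^ (c₀ * n ^ 4 * (⌈log₂ n ⌉ ^ 2)) ≤ N →
    (M : Matrix O (64 * n ^ 4) N) → HasMonotoneSubmatrix O n M))
theorem5 = 44 * 64 , s≤s z≤n , λ O n 1≤n N N≥ M → cases O n 1≤n N N≥ M (m≤n⇒m<n∨m≡n 1≤n)
  where
  cases : ∀ O n → n ≥ 1 → ∀ N → 2 ^ (44 * 64 * n ^ 4 * (⌈log₂ n ⌉ ^ 2)) ≤ N →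
          (M : Matrix O (64 * n ^ 4) N) → 1 < n ⊎ 1 ≡ n → HasMonotoneSubmatrix O n M
  cases O n 1≤n N N≥ M (inj₁ 1<n) =
    large-case O refl refl refl 1≤n (⌈log₂⌉>0 1<n) (n≤2^⌈log₂n⌉ n) (2^⌈log₂n⌉<2n n {{>-nonZero 1≤n}})
      (≤-reflexive (square n)) (columns-bound refl refl refl 1≤n (⌈log₂⌉>0 1<n) N≥) M
    where
    square : ∀ n → 8 * (n * n) * (8 * (n * n)) ≡ 64 * (n * (n * (n * (n * 1))))
    square = solve-∀
  -- Since `⌈log₂ 1 ⌉` is 0, the hypothesis here reads `1 ≤ N`, and a single entry is monotone
  -- vacuously.
  cases O _ _ N N≥ M (inj₂ refl) = unit-case O (s≤s z≤n) N≥ M
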